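{- For each integer $k\geq 3$ there is a convexity space $(X,\mathcal{F})$ such that its second Radon number satisfies $r_2=4$, but its $k$-th Radon number satisfies $r_k\geq 3(k-1)+2$.
   Context: A convexity space on a ground set $X$ is a family $\mathcal{F}\subset 2^X$ (whose members are called convex sets) such that $\emptyset\in\mathcal{F}$, $X\in\mathcal{F}$, and the intersection of any collection of members of $\mathcal{F}$ belongs to $\mathcal{F}$. The convex hull $\operatorname{conv} P$ of $P\subset X$ is the intersection of all convex sets containing $P$. The $k$-th Radon number $r_k$ of $(X,\mathcal{F})$ is the minimum natural number, if it exists, such that every set $P\subset X$ with at least $r_k$ points admits a partition $P=P_1\cup\dots\cup P_k$ into $k$ parts with $\operatorname{conv}P_1\cap\dots\cap\operatorname{conv}P_k\neq\emptyset$. -}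

module Defs where

open import Data.Nat using (ℕ; _≤_; _∸_)
open import Relation.Nullary using (¬_)
open import Data.Fin using (Fin)
open import Data.Empty using (⊥)
open import Data.Unit using (⊤)
open import Data.Product using (Σ; _×_)
open import Relation.Binary.PropositionalEquality using (_≡_)
open import Function.Definitions using (Injective)

record ConvexitySpace (X : Set) : Set₁ where
  field
    Convex    : (X → Set) → Set
    empty-convex : Convex (λ _ → ⊥)
    full-convex  : Convex (λ _ → ⊤)
    ⋂-convex  : (I : Set) (C : I → X → Set) →
                (∀ i → Convex (C i)) → Convex (λ x → ∀ i → C i x)

module _ {X : Set} (S : ConvexitySpace X) where
  open ConvexitySpace S

  conv : (X → Set) → X → Set₁
  conv P x = (C : X → Set) → Convex C → (∀ y → P y → C y) → C x

  AtLeast : ℕ → (X → Set) → Set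
  AtLeast N P = Σ (Fin N → X) λ f → Injective _≡_ _≡_ f × (∀ j → P (f j))

  Part : {k : ℕ} (P : X → Set) → (∀ x → P x → Fin k) → Fin k → X → Set
  Part P c i x = Σ (P x) λ p → c x p ≡ i

  HasRadonPartition : ℕ → (X → Set) → Set₁
  HasRadonPartition k P =
    Σ (∀ x → P x → Fin k) λ c → Σ X λ z → ∀ i → conv (Part P c i) z

  RadonProperty : ℕ → ℕ → Set₁
  RadonProperty k N = ∀ (P : X → Set) → AtLeast N P → HasRadonPartition k P

  IsRadonNumber : ℕ → ℕ → Set₁
  IsRadonNumber k r = RadonProperty k r × (∀ m → RadonProperty k m → r ≤ m)

  -- r_k ≥ m : the Radon property fails for m - 1 points, i.e. some set
  -- with at least m - 1 points has no Radon k-partition (so r_k, if it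
  -- exists, is ≥ m; if it does not exist, r_k = ∞ ≥ m)
  RadonNumberAtLeast : ℕ → ℕ → Set₁
  RadonNumberAtLeast k m = ¬ RadonProperty k (m ∸ 1)

{-# OPTIONS --safe #-}
-- Let n = 3k − 2.  A point of a convexity space is determined by the sets A of
-- a fixed n-set (the vertices) whose hull contains it, and these sets may be
-- prescribed: let the convex sets be the intersections of sets {y | A ∈ y}.  Use three kinds
-- of points: a vertex a (all A containing a), a segment g (A = g or |A| ≥ 3) and
-- a crossing of two disjoint pairs e, f (A = e, A = f, or |A| ≥ 3 and A meets
-- e ∪ f).  Two essentially different points share at most one pair, and this
-- linearity yields a Radon partition of any four points.  On the other hand, k
-- disjoint sets belonging to one segment or crossing all have at least three
-- elements, except one which has two, so they would need 3k − 1 vertices.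
module Submission where

open import Defs
open import Data.Nat using (ℕ; suc; z≤n; s≤s; _≤_; _*_; _+_; _∸_; _≤?_)
open import Data.Nat.Properties using (≤-trans; ≤-refl; ≤-reflexive; ≰⇒>; ≤-pred; +-monoˡ-≤; n≮n; *-comm; *-suc; +-comm)
open import Data.Bool using (Bool; T)
open import Data.Empty using (⊥; ⊥-elim; ⊥-elim-irr)
open import Data.Unit using (⊤; tt)
open import Data.Fin using (Fin; zero; suc; _<_; _≟_; inject≤; remQuot; combine; punchIn)
open import Data.Fin.Patterns using (0F; 1F; 2F; 3F)
open import Data.Fin.Properties using (<-cmp; <-asym; <⇒≢; any?; injective⇒≤; inject≤-injective; combine-remQuot; punchInᵢ≢i; suc-injective)
open import Data.Product using (Σ; ∃; _×_; _,_; proj₁; proj₂; uncurry)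
open import Data.Sum using (_⊎_; inj₁; inj₂; swap; [_,_])
open import Function using (_∘_; id)
open import Function.Definitions using (Injective)
open import Relation.Binary.Definitions using (DecidableEquality; tri<; tri≈; tri>)
open import Relation.Binary.PropositionalEquality using (_≡_; _≢_; refl; sym; trans; cong; subst)
open import Relation.Nullary using (¬_; Dec; yes; no; contradiction)
open import Relation.Nullary.Decidable using (⌊_⌋; toWitness; fromWitness; map′; ¬?; _×-dec_; _⊎-dec_; decidable-stable)
open import Relation.Unary using (Decidable)

private
  variable
    n k m : ℕ

-- Pairs of vertices

-- Ordering the endpoints gives each two-element set a single representative, and irrelevance of the
-- order proof lets equality be decided on the endpoints alone.
record Edge (n : ℕ) : Set where
  constructor edge
  field
    lo hi  : Fin n
    .lo<hi : lo < hi
open Edge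

infix 4 _∈ᵉ_ _∈_ _≼_

_∈ᵉ_ : Fin n → Edge n → Set
a ∈ᵉ e = a ≡ lo e ⊎ a ≡ hi e

_∈ᵉ?_ : (a : Fin n) (e : Edge n) → Dec (a ∈ᵉ e)
a ∈ᵉ? e = (a ≟ lo e) ⊎-dec (a ≟ hi e)

_≟ᵉ_ : DecidableEquality (Edge n)
edge a b _ ≟ᵉ edge c d _ with a ≟ c | b ≟ d
... | yes refl | yes refl = yes refl
... | no a≢c   | _        = no λ { refl → a≢c refl }
... | yes _    | no b≢d   = no λ { refl → b≢d refl }

module _ {a b : Fin n} (a≢b : a ≢ b) where

  join : Edge n
  join with <-cmp a b
  ... | tri< a<b _ _ = edge a b a<b
  ... | tri≈ _ a≡b _ = contradiction a≡b a≢b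
  ... | tri> _ _ b<a = edge b a b<a

  ∈-join⁻ : ∀ {x} → x ∈ᵉ join → x ≡ a ⊎ x ≡ b
  ∈-join⁻ x∈ with <-cmp a b
  ... | tri< _ _ _   = x∈
  ... | tri≈ _ a≡b _ = contradiction a≡b a≢b
  ... | tri> _ _ _   = swap x∈

  ∈-joinˡ : a ∈ᵉ join
  ∈-joinˡ with <-cmp a b
  ... | tri< _ _ _   = inj₁ refl
  ... | tri≈ _ a≡b _ = contradiction a≡b a≢b
  ... | tri> _ _ _   = inj₂ refl

  ∈-joinʳ : b ∈ᵉ join
  ∈-joinʳ with <-cmp a b
  ... | tri< _ _ _   = inj₂ refl
  ... | tri≈ _ a≡b _ = contradiction a≡b a≢b
  ... | tri> _ _ _   = inj₁ refl

edge-unique : {a b : Fin n} {e f : Edge n} → a ≢ b →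
              a ∈ᵉ e → b ∈ᵉ e → a ∈ᵉ f → b ∈ᵉ f → e ≡ f
edge-unique a≢b (inj₁ refl) (inj₁ refl) _ _ = contradiction refl a≢b
edge-unique a≢b (inj₂ refl) (inj₂ refl) _ _ = contradiction refl a≢b
edge-unique a≢b _ _ (inj₁ refl) (inj₁ refl) = contradiction refl a≢b
edge-unique a≢b _ _ (inj₂ refl) (inj₂ refl) = contradiction refl a≢b
edge-unique a≢b (inj₁ refl) (inj₂ refl) (inj₁ refl) (inj₂ refl) = refl
edge-unique a≢b (inj₂ refl) (inj₁ refl) (inj₂ refl) (inj₁ refl) = refl
edge-unique {e = edge x y x<y} {edge _ _ y<x} a≢b (inj₁ refl) (inj₂ refl) (inj₂ refl) (inj₁ refl) =
  ⊥-elim-irr (<-asym {x = x} {y} x<y y<x)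
edge-unique {e = edge x y x<y} {edge _ _ y<x} a≢b (inj₂ refl) (inj₁ refl) (inj₁ refl) (inj₂ refl) =
  ⊥-elim-irr (<-asym {x = x} {y} x<y y<x)

Disjoint : Edge n → Edge n → Set
Disjoint e f = ∀ x → x ∈ᵉ e → x ∈ᵉ f → ⊥

disjoint-sym : (e f : Edge n) → Disjoint e f → Disjoint f e
disjoint-sym _ _ d x x∈f x∈e = d x x∈e x∈f

-- Points and the convexity space

-- `crossing e f` and `crossing f e` are different points with the same probes, so points are mostly
-- compared by `≼` below and not by equality.
data Point (n : ℕ) : Set where
  vertex   : Fin n → Point n
  segment  : Edge n → Point n
  crossing : (e f : Edge n) → .(Disjoint e f) → Point n

-- Sets of vertices sorted by cardinality.  Nothing forces B in big B to have
-- three elements; the probes big B with smaller B are harmless.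
data Probe (n : ℕ) : Set where
  none   : Probe n
  single : Fin n → Probe n
  pair   : Edge n → Probe n
  big    : (Fin n → Bool) → Probe n

-- The intended reading of `t ∈ y` is that `y` lies in the hull of the vertex set `t`. As `none` has
-- no points, the empty set becomes convex.
_∈_ : Probe n → Point n → Set
none     ∈ _              = ⊥
single a ∈ vertex c       = a ≡ c
single a ∈ segment _      = ⊥
single a ∈ crossing _ _ _ = ⊥
pair e   ∈ vertex c       = c ∈ᵉ e
pair e   ∈ segment g      = e ≡ g
pair e   ∈ crossing f g _ = e ≡ f ⊎ e ≡ g
big B    ∈ vertex c       = T (B c)
big B    ∈ segment _      = ⊤
big B    ∈ crossing e f _ = Σ _ λ v → (v ∈ᵉ e ⊎ v ∈ᵉ f) × T (B v)

_≟ᵖ_ : DecidableEquality (Point n)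
vertex a ≟ᵖ vertex b = map′ (cong vertex) (λ { refl → refl }) (a ≟ b)
vertex _ ≟ᵖ segment _ = no λ ()
vertex _ ≟ᵖ crossing _ _ _ = no λ ()
segment _ ≟ᵖ vertex _ = no λ ()
segment e ≟ᵖ segment f = map′ (cong segment) (λ { refl → refl }) (e ≟ᵉ f)
segment _ ≟ᵖ crossing _ _ _ = no λ ()
crossing _ _ _ ≟ᵖ vertex _ = no λ ()
crossing _ _ _ ≟ᵖ segment _ = no λ ()
crossing e f _ ≟ᵖ crossing g h _ =
  map′ (λ { (refl , refl) → refl }) (λ { refl → refl , refl }) ((e ≟ᵉ g) ×-dec (f ≟ᵉ h))

-- Intersections of sets `t ∈_` are described as closed sets: a point lying in every such set that
-- includes `C` lies in `C`. Quantifying over probes instead of families keeps `Convex` in `Set`.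
space : (n : ℕ) → ConvexitySpace (Point n)
space n = record
  { Convex       = λ C → ∀ z → (∀ t → (∀ y → C y → t ∈ y) → t ∈ z) → C z
  ; empty-convex = λ z h → h none λ _ ()
  ; full-convex  = λ _ _ → tt
  ; ⋂-convex     = λ I C conv z h i → conv i z λ t t∈C → h t λ y y∈ → t∈C y (y∈ i)
  }

-- Each set `t ∈_` is itself convex. With the converse below, membership in a hull is tested on
-- probes alone.
∈-conv⁻ : {P : Point n → Set} {z : Point n} → conv (space n) P z →
          ∀ t → (∀ y → P y → t ∈ y) → t ∈ z
∈-conv⁻ z∈ t = z∈ (t ∈_) λ _ h → h t λ _ → id

∈-conv⁺ : {P : Point n → Set} {z : Point n} →
          (∀ t → (∀ y → P y → t ∈ y) → t ∈ z) → conv (space n) P z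
∈-conv⁺ h C C-convex P⊆C = C-convex _ λ t t∈C → h t λ y Py → t∈C y (P⊆C y Py)

-- Radon partitions of four points

_≼_ : Point n → Point n → Set
y ≼ z = ∀ t → t ∈ y → t ∈ z

-- This puts `z` in the hull of `x` and `y`, just as `y ≼ z` puts `z` in the hull of `y` alone.
_⊓_⊑_ : Point n → Point n → Point n → Set
x ⊓ y ⊑ z = ∀ t → t ∈ x → t ∈ y → t ∈ z

-- Colours are attached to positions and not to points, so repeated points cause no trouble and the
-- four points can be permuted freely.
record Splits (y₀ y₁ y₂ y₃ : Point n) : Set where
  constructor splits
  field
    z           : Point n
    s₀ s₁ s₂ s₃ : Fin 2
    common      : ∀ t i → (s₀ ≡ i → t ∈ y₀) → (s₁ ≡ i → t ∈ y₁) →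
                  (s₂ ≡ i → t ∈ y₂) → (s₃ ≡ i → t ∈ y₃) → t ∈ z

module _ {y₀ y₁ y₂ y₃ : Point n} where

  splits₂₂ : ∀ {z} → y₀ ⊓ y₁ ⊑ z → y₂ ⊓ y₃ ⊑ z → Splits y₀ y₁ y₂ y₃
  splits₂₂ l r = splits _ zero zero (suc zero) (suc zero) λ where
    t zero       p q _ _ → l t (p refl) (q refl)
    t (suc zero) _ _ p q → r t (p refl) (q refl)

  splits₁₃ : (∀ t → t ∈ y₁ → t ∈ y₂ → t ∈ y₃ → t ∈ y₀) → Splits y₀ y₁ y₂ y₃
  splits₁₃ r = splits y₀ zero (suc zero) (suc zero) (suc zero) λ where
    t zero       p _ _ _ → p refl
    t (suc zero) _ p q s → r t (p refl) (q refl) (s refl)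

  exchange₀₁ : Splits y₁ y₀ y₂ y₃ → Splits y₀ y₁ y₂ y₃
  exchange₀₁ (splits z s₀ s₁ s₂ s₃ c) = splits z s₁ s₀ s₂ s₃ λ t i p q → c t i q p

  exchange₁₂ : Splits y₀ y₂ y₁ y₃ → Splits y₀ y₁ y₂ y₃
  exchange₁₂ (splits z s₀ s₁ s₂ s₃ c) = splits z s₀ s₂ s₁ s₃ λ t i p q r → c t i p r q

  exchange₂₃ : Splits y₀ y₁ y₃ y₂ → Splits y₀ y₁ y₂ y₃
  exchange₂₃ (splits z s₀ s₁ s₂ s₃ c) = splits z s₀ s₁ s₃ s₂ λ t i p q r s → c t i p q s r

  -- Moving a point up in `≼` stays inside its hull, so hulls of classes only shrink. Used to list
  -- the edges of crossings in a convenient order.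
  splits-antitone : ∀ {y₀′ y₁′ y₂′ y₃′} → y₀ ≼ y₀′ → y₁ ≼ y₁′ → y₂ ≼ y₂′ → y₃ ≼ y₃′ →
                    Splits y₀′ y₁′ y₂′ y₃′ → Splits y₀ y₁ y₂ y₃
  splits-antitone l₀ l₁ l₂ l₃ (splits z s₀ s₁ s₂ s₃ c) = splits z s₀ s₁ s₂ s₃ λ t i p q r s →
    c t i (l₀ t ∘ p) (l₁ t ∘ q) (l₂ t ∘ r) (l₃ t ∘ s)

-- The Radon point is `y₁`: it stands alone against the other three, and `y₀` already has it in its
-- hull.
≼⇒splits : {y₀ y₁ y₂ y₃ : Point n} → y₀ ≼ y₁ → Splits y₀ y₁ y₂ y₃
≼⇒splits le = exchange₀₁ (splits₁₃ λ t p _ _ → le t p)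

≼⇒splits₁₂ : {y₀ y₁ y₂ y₃ : Point n} → y₁ ≼ y₂ → Splits y₀ y₁ y₂ y₃
≼⇒splits₁₂ le = exchange₀₁ (exchange₁₂ (≼⇒splits le))

≼⇒splits₂₃ : {y₀ y₁ y₂ y₃ : Point n} → y₂ ≼ y₃ → Splits y₀ y₁ y₂ y₃
≼⇒splits₂₃ le = exchange₁₂ (exchange₂₃ (≼⇒splits₁₂ le))

≼-refl : {y : Point n} → y ≼ y
≼-refl _ = id

crossing-comm : ∀ (e f : Edge n) .{d} .{d′} → crossing e f d ≼ crossing f e d′
crossing-comm _ _ (pair _) = swap
crossing-comm _ _ (big _) (v , v∈ , Bv) = v , swap v∈ , Bv

-- Every `big` probe contains every segment, so only singletons and pairs could be an obstruction.
no-pair⇒⊑segment : ∀ {y y′ : Point n} {g} → (∀ {a} → ¬ single a ∈ y) →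
                   (∀ {e} → pair e ∈ y → ¬ pair e ∈ y′) → y ⊓ y′ ⊑ segment g
no-pair⇒⊑segment ¬single ¬pair (single _) p _ = ¬single p
no-pair⇒⊑segment ¬single ¬pair (pair _) p q = contradiction q (¬pair p)
no-pair⇒⊑segment ¬single ¬pair (big _) _ _ = tt

-- Linearity: the pairs shared by two points

Meet : Point n → Point n → Set
Meet y y′ = y ≼ y′ ⊎ Σ _ λ e → y ⊓ y′ ⊑ segment e

meet-vertex-crossing : ∀ (a : Fin n) e f .d → Σ _ λ g → vertex a ⊓ crossing e f d ⊑ segment g
meet-vertex-crossing a e f d with a ∈ᵉ? e
... | yes a∈e = e , λ where
  (pair _) p (inj₁ refl) → refl
  (pair _) p (inj₂ refl) → ⊥-elim-irr (d _ a∈e p)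
  (big _)  _ _           → tt
... | no a∉e = f , λ where
  (pair _) p (inj₁ refl) → contradiction p a∉e
  (pair _) p (inj₂ refl) → refl
  (big _)  _ _           → tt

pair∈crossing? : ∀ (e f g : Edge n) → Dec (e ≡ f ⊎ e ≡ g)
pair∈crossing? e f g = (e ≟ᵉ f) ⊎-dec (e ≟ᵉ g)

-- Unless `y ≼ y′`, the two points share no singleton and at most one pair. The segment on that pair
-- is then in their hull; if no pair is shared, any segment is.
meet : (y y′ : Point n) → Meet y y′
meet (segment g) y = inj₂ (g , λ _ p _ → p)
meet y (segment g) = inj₂ (g , λ _ _ q → q)
meet (vertex a) (vertex b) with a ≟ b
... | yes refl = inj₁ ≼-refl
... | no a≢b = inj₂ (join a≢b , λ where
  (single _) refl refl → a≢b refl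
  (pair _)   p    q    → edge-unique a≢b p q (∈-joinˡ a≢b) (∈-joinʳ a≢b)
  (big _)    _    _    → tt)
meet (vertex a) (crossing e f d) = inj₂ (meet-vertex-crossing a e f d)
meet (crossing e f d) (vertex a) with meet-vertex-crossing a e f d
... | g , le = inj₂ (g , λ t p q → le t q p)
meet (crossing e f d) (crossing g h _) with pair∈crossing? e g h | pair∈crossing? f g h
... | no e∉ | _ = inj₂ (f , λ where
  (pair _) (inj₁ refl) q → contradiction q e∉
  (pair _) (inj₂ refl) _ → refl
  (big _)  _           _ → tt)
... | yes _ | no f∉ = inj₂ (e , λ where
  (pair _) (inj₁ refl) _ → refl
  (pair _) (inj₂ refl) q → contradiction q f∉
  (big _)  _           _ → tt)
... | yes e∈ | yes f∈ = inj₁ λ where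
    (pair _) (inj₁ refl)       → e∈
    (pair _) (inj₂ refl)       → f∈
    (big _) (v , inj₁ v∈ , Bv) → v , on e∈ v∈ , Bv
    (big _) (v , inj₂ v∈ , Bv) → v , on f∈ v∈ , Bv
  where
  on : ∀ {e v} → e ≡ g ⊎ e ≡ h → v ∈ᵉ e → v ∈ᵉ g ⊎ v ∈ᵉ h
  on (inj₁ refl) = inj₁
  on (inj₂ refl) = inj₂

meet-at : ∀ (y y′ : Point n) {e} → pair e ∈ y → pair e ∈ y′ → y ≼ y′ ⊎ (y ⊓ y′ ⊑ segment e)
meet-at y y′ {e} p q with meet y y′
... | inj₁ le = inj₁ le
... | inj₂ (g , le) with le (pair e) p q
...   | refl = inj₂ le

-- Since `y₀` and `y₁` have all segments in their hull, they have the one that `meet` finds in the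
-- hull of `y₂` and `y₃`.
⊑segment⇒splits : ∀ {y₀ y₁ y₂ y₃ : Point n} → (∀ {g} → y₀ ⊓ y₁ ⊑ segment g) → Splits y₀ y₁ y₂ y₃
⊑segment⇒splits {y₂ = y₂} {y₃} apart with meet y₂ y₃
... | inj₁ le       = ≼⇒splits₂₃ le
... | inj₂ (_ , le) = splits₂₂ apart le

pair∈? : ∀ (e : Edge n) y → Dec (pair e ∈ y)
pair∈? e (vertex c)       = c ∈ᵉ? e
pair∈? e (segment g)      = e ≟ᵉ g
pair∈? e (crossing f g _) = pair∈crossing? e f g

-- The only pair of `segment g` is `g`. If `y₂` or `y₃` lacks it, that point shares no pair with the
-- segment; if both have it, `meet-at` makes `segment g` the Radon point unless `y₂ ≼ y₃`.
segment-splits : ∀ (g : Edge n) y₁ y₂ y₃ → Splits (segment g) y₁ y₂ y₃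
segment-splits g y₁ y₂ y₃ with pair∈? g y₂ | pair∈? g y₃
... | no g∉ | _ =
  exchange₁₂ (⊑segment⇒splits (no-pair⇒⊑segment {y = segment g} {y₂} (λ ()) λ { refl → g∉ }))
... | yes _ | no g∉ = exchange₂₃ (exchange₁₂
  (⊑segment⇒splits (no-pair⇒⊑segment {y = segment g} {y₃} (λ ()) λ { refl → g∉ })))
... | yes g∈₂ | yes g∈₃ with meet-at y₂ y₃ g∈₂ g∈₃
...   | inj₁ le = ≼⇒splits₂₃ le
...   | inj₂ le = splits₂₂ (λ _ p _ → p) le

-- Four points that are vertices or crossings

On : Fin n → Edge n → Edge n → Set
On a e f = a ∈ᵉ e ⊎ a ∈ᵉ f

on? : ∀ (a : Fin n) e f → Dec (On a e f)
on? a e f = (a ∈ᵉ? e) ⊎-dec (a ∈ᵉ? f)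

off⇒⊑segment : ∀ {a : Fin n} {e f g} .{d} → ¬ On a e f → vertex a ⊓ crossing e f d ⊑ segment g
off⇒⊑segment a∉ (pair _) p (inj₁ refl) = contradiction (inj₁ p) a∉
off⇒⊑segment a∉ (pair _) p (inj₂ refl) = contradiction (inj₂ p) a∉
off⇒⊑segment a∉ (big _) _ _ = tt

-- The only pair through both vertices is `e`, and a `big` probe of `vertex a` meets `e` in `a`.
vertices⊑crossing : ∀ {a b : Fin n} {e f} .{d} → a ≢ b → a ∈ᵉ e → b ∈ᵉ e →
                    vertex a ⊓ vertex b ⊑ crossing e f d
vertices⊑crossing a≢b a∈ b∈ (single _) refl refl = contradiction refl a≢b
vertices⊑crossing a≢b a∈ b∈ (pair _) p q = inj₁ (edge-unique a≢b p q a∈ b∈)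
vertices⊑crossing a≢b a∈ b∈ (big _) p _ = _ , inj₁ a∈ , p

vertices⊑crossing′ : ∀ {a b : Fin n} {e f} .{d} → a ≢ b → a ∈ᵉ f → b ∈ᵉ f →
                     vertex a ⊓ vertex b ⊑ crossing e f d
vertices⊑crossing′ {e = e} {f} {d} a≢b a∈ b∈ t p q =
  crossing-comm f e {disjoint-sym e f d} t (vertices⊑crossing a≢b a∈ b∈ t p q)

-- Distinct vertices act like points in convex position: the pairs `a`, `b` and `c`, `d` cross. This
-- case is what crossings are made for.
splits-vvvv : ∀ (a b c d : Fin n) → Splits (vertex a) (vertex b) (vertex c) (vertex d)
splits-vvvv a b c d with a ≟ b | a ≟ c | a ≟ d | b ≟ c | b ≟ d | c ≟ d
... | yes refl | _ | _ | _ | _ | _ = ≼⇒splits ≼-refl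
... | _ | yes refl | _ | _ | _ | _ = exchange₁₂ (≼⇒splits ≼-refl)
... | _ | _ | yes refl | _ | _ | _ = exchange₂₃ (exchange₁₂ (≼⇒splits ≼-refl))
... | _ | _ | _ | yes refl | _ | _ = ≼⇒splits₁₂ ≼-refl
... | _ | _ | _ | _ | yes refl | _ = exchange₂₃ (≼⇒splits₁₂ ≼-refl)
... | _ | _ | _ | _ | _ | yes refl = ≼⇒splits₂₃ ≼-refl
... | no a≢b | no a≢c | no a≢d | no b≢c | no b≢d | no c≢d =
  splits₂₂ {z = crossing (join a≢b) (join c≢d) disjoint}
    (vertices⊑crossing a≢b (∈-joinˡ a≢b) (∈-joinʳ a≢b))
    (vertices⊑crossing′ c≢d (∈-joinˡ c≢d) (∈-joinʳ c≢d))
  where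
  disjoint : Disjoint (join a≢b) (join c≢d)
  disjoint _ p q with ∈-join⁻ a≢b p | ∈-join⁻ c≢d q
  ... | inj₁ refl | inj₁ refl = a≢c refl
  ... | inj₁ refl | inj₂ refl = a≢d refl
  ... | inj₂ refl | inj₁ refl = b≢c refl
  ... | inj₂ refl | inj₂ refl = b≢d refl

-- A vertex off both edges shares no pair with the crossing. Otherwise two of the three vertices are
-- on the same edge, and the crossing is in their hull.
splits-vvvc : ∀ (a b c : Fin n) e f .d → Splits (vertex a) (vertex b) (vertex c) (crossing e f d)
splits-vvvc {n} a b c e f d = go (on? a e f) (on? b e f) (on? c e f)
  where
  Goal : Fin n → Fin n → Fin n → Set
  Goal a b c = Splits (vertex a) (vertex b) (vertex c) (crossing e f d)

  off : ∀ {a b c} → ¬ On c e f → Goal a b c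
  off c∉ = exchange₁₂ (exchange₀₁ (exchange₂₃ (exchange₁₂ (⊑segment⇒splits (off⇒⊑segment c∉)))))

  same : ∀ {a b c} → (a ∈ᵉ e × b ∈ᵉ e) ⊎ (a ∈ᵉ f × b ∈ᵉ f) → Goal a b c
  same {a} {b} ab∈ with a ≟ b
  ... | yes refl = ≼⇒splits ≼-refl
  ... | no a≢b = splits₂₂ {z = crossing e f d} (join⊑ ab∈) (λ _ _ q → q)
    where
    join⊑ : (a ∈ᵉ e × b ∈ᵉ e) ⊎ (a ∈ᵉ f × b ∈ᵉ f) → vertex a ⊓ vertex b ⊑ crossing e f d
    join⊑ (inj₁ (a∈ , b∈)) = vertices⊑crossing a≢b a∈ b∈
    join⊑ (inj₂ (a∈ , b∈)) = vertices⊑crossing′ a≢b a∈ b∈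

  go : Dec (On a e f) → Dec (On b e f) → Dec (On c e f) → Goal a b c
  go (no a∉) _ _ = exchange₀₁ (exchange₁₂ (off a∉))
  go _ (no b∉) _ = exchange₁₂ (off b∉)
  go _ _ (no c∉) = off c∉
  go (yes (inj₁ a∈)) (yes (inj₁ b∈)) _ = same (inj₁ (a∈ , b∈))
  go (yes (inj₂ a∈)) (yes (inj₂ b∈)) _ = same (inj₂ (a∈ , b∈))
  go (yes (inj₁ a∈)) _ (yes (inj₁ c∈)) = exchange₁₂ (same (inj₁ (a∈ , c∈)))
  go (yes (inj₂ a∈)) _ (yes (inj₂ c∈)) = exchange₁₂ (same (inj₂ (a∈ , c∈)))
  go _ (yes (inj₁ b∈)) (yes (inj₁ c∈)) = exchange₀₁ (exchange₁₂ (same (inj₁ (b∈ , c∈))))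
  go _ (yes (inj₂ b∈)) (yes (inj₂ c∈)) = exchange₀₁ (exchange₁₂ (same (inj₂ (b∈ , c∈))))

-- The main case has `a` and `b` on both crossings. If one edge of the second crossing carries both,
-- that crossing is the Radon point; otherwise the first crossing is, standing alone against the
-- rest.
splits-vvcc : ∀ (a b : Fin n) e f g h .d .d′ →
              Splits (vertex a) (vertex b) (crossing e f d) (crossing g h d′)
splits-vvcc {n} a b e f g h d d′ with a ≟ b
... | yes refl = ≼⇒splits ≼-refl
... | no a≢b = go (on? a e f) (on? b e f) (on? a g h) (on? b g h)
  where
  Goal : Set
  Goal = Splits (vertex a) (vertex b) (crossing e f d) (crossing g h d′)

  -- The only pair containing a and b is not an edge of the crossing of g and h.
  apart : ∀ {g h} .{d′} → a ∈ᵉ g → b ∈ᵉ h → On a e f →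
          ∀ t → t ∈ vertex a → t ∈ vertex b → t ∈ crossing g h d′ → t ∈ crossing e f d
  apart a∈ b∈ a∈ef (single _) refl refl ()
  apart {d′ = d′} a∈ b∈ a∈ef (pair _) p q (inj₁ refl) = ⊥-elim-irr (d′ _ q b∈)
  apart {d′ = d′} a∈ b∈ a∈ef (pair _) p q (inj₂ refl) = ⊥-elim-irr (d′ _ a∈ p)
  apart a∈ b∈ a∈ef (big _) p _ _ = a , a∈ef , p

  apart′ : a ∈ᵉ h → b ∈ᵉ g → On a e f →
           ∀ t → t ∈ vertex a → t ∈ vertex b → t ∈ crossing g h d′ → t ∈ crossing e f d
  apart′ a∈ b∈ a∈ef t p q r =
    apart {d′ = disjoint-sym g h d′} a∈ b∈ a∈ef t p q (crossing-comm g h t r)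

  to-front : Splits (crossing e f d) (vertex a) (vertex b) (crossing g h d′) → Goal
  to-front = exchange₁₂ ∘ exchange₀₁

  go : Dec (On a e f) → Dec (On b e f) → Dec (On a g h) → Dec (On b g h) → Goal
  go (no a∉) _ _ _ = exchange₁₂ (⊑segment⇒splits (off⇒⊑segment a∉))
  go _ (no b∉) _ _ = exchange₀₁ (exchange₁₂ (⊑segment⇒splits (off⇒⊑segment b∉)))
  go _ _ (no a∉) _ = exchange₂₃ (exchange₁₂ (⊑segment⇒splits (off⇒⊑segment a∉)))
  go _ _ _ (no b∉) = exchange₀₁ (exchange₂₃ (exchange₁₂ (⊑segment⇒splits (off⇒⊑segment b∉))))
  go _ _ (yes (inj₁ a∈)) (yes (inj₁ b∈)) =
    splits₂₂ {z = crossing g h d′} (vertices⊑crossing a≢b a∈ b∈) λ _ _ q → q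
  go _ _ (yes (inj₂ a∈)) (yes (inj₂ b∈)) =
    splits₂₂ {z = crossing g h d′} (vertices⊑crossing′ a≢b a∈ b∈) λ _ _ q → q
  go (yes a∈ef) _ (yes (inj₁ a∈)) (yes (inj₂ b∈)) = to-front (splits₁₃ (apart {d′ = d′} a∈ b∈ a∈ef))
  go (yes a∈ef) _ (yes (inj₂ a∈)) (yes (inj₁ b∈)) = to-front (splits₁₃ (apart′ a∈ b∈ a∈ef))

-- Allows the edges e, f of a crossing y to be listed in either order.
record Crossing (e f : Edge n) (y : Point n) : Set where
  constructor crosses
  field
    .disjoint : Disjoint e f
    to        : y ≼ crossing e f disjoint

∈⇒Crossing : ∀ {e g h : Edge n} .d → pair e ∈ crossing g h d → ∃ λ f → Crossing e f (crossing g h d)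
∈⇒Crossing d (inj₁ refl) = _ , crosses d ≼-refl
∈⇒Crossing {g = g} {h} d (inj₂ refl) = _ , crosses (disjoint-sym g h d) (crossing-comm g h)

On⇒Crossing : ∀ {a : Fin n} g h .d → On a g h → ∃ λ e → ∃ λ f → a ∈ᵉ e × Crossing e f (crossing g h d)
On⇒Crossing _ _ d (inj₁ a∈) = _ , _ , a∈ , crosses d ≼-refl
On⇒Crossing g h d (inj₂ a∈) = _ , _ , a∈ , crosses (disjoint-sym g h d) (crossing-comm g h)

vertex-edge-unique : ∀ {a : Fin n} {e f g} .{d : Disjoint e f} → a ∈ᵉ e → a ∈ᵉ g →
                     pair g ∈ crossing e f d → g ≡ e
vertex-edge-unique a∈ p (inj₁ refl) = refl
vertex-edge-unique {d = d} a∈ p (inj₂ refl) = ⊥-elim-irr (d _ a∈ p)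

-- With `a` on all three crossings, let `gᵢ` be the edge through `a`. If `g₁` and `g₂` agree, the
-- first crossing is in the hull of the rest; if not, `a` and the first two crossings have no common
-- pair, and the third is in their hull.
splits-vccc : ∀ (a : Fin n) {e₁ f₁ e₂ f₂ e₃ f₃} .d₁ .d₂ .d₃ →
              Splits (vertex a) (crossing e₁ f₁ d₁) (crossing e₂ f₂ d₂) (crossing e₃ f₃ d₃)
splits-vccc a {e₁} {f₁} {e₂} {f₂} {e₃} {f₃} d₁ d₂ d₃
  with on? a e₁ f₁ | on? a e₂ f₂ | on? a e₃ f₃
... | no a∉ | _ | _ = ⊑segment⇒splits (off⇒⊑segment a∉)
... | _ | no a∉ | _ = exchange₁₂ (⊑segment⇒splits (off⇒⊑segment a∉))
... | _ | _ | no a∉ = exchange₂₃ (exchange₁₂ (⊑segment⇒splits (off⇒⊑segment a∉)))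
... | yes a∈₁ | yes a∈₂ | yes a∈₃
  with On⇒Crossing e₁ f₁ d₁ a∈₁ | On⇒Crossing e₂ f₂ d₂ a∈₂ | On⇒Crossing e₃ f₃ d₃ a∈₃
... | g₁ , h₁ , a∈g₁ , crosses c₁ to₁ | g₂ , h₂ , a∈g₂ , crosses c₂ to₂ | g₃ , h₃ , a∈g₃ , crosses c₃ to₃ =
  splits-antitone ≼-refl to₁ to₂ to₃ (go (g₁ ≟ᵉ g₂))
  where
  go : Dec (g₁ ≡ g₂) → Splits (vertex a) (crossing g₁ h₁ c₁) (crossing g₂ h₂ c₂) (crossing g₃ h₃ c₃)
  go (yes refl) = exchange₀₁ (splits₁₃ λ where
    (pair _) p q _ → inj₁ (vertex-edge-unique {d = c₂} a∈g₂ p q)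
    (big _)  p _ _ → a , inj₁ a∈g₁ , p)
  go (no g₁≢g₂) = exchange₂₃ (exchange₁₂ (exchange₀₁ (splits₁₃ λ where
    (pair _) p q r → contradiction
      (trans (sym (vertex-edge-unique {d = c₁} a∈g₁ p q)) (vertex-edge-unique {d = c₂} a∈g₂ p r)) g₁≢g₂
    (big _)  p _ _ → a , inj₁ a∈g₃ , p)))

-- If e is not an edge of the fourth crossing then f₁, f₂, f₃ are, so two of them
-- coincide, unless one of the first three crossings shares no edge with the fourth.
splits-common : ∀ {e f₁ f₂ f₃ g h : Edge n} .d₁ .d₂ .d₃ .d →
  Splits (crossing e f₁ d₁) (crossing e f₂ d₂) (crossing e f₃ d₃) (crossing g h d)
splits-common {n} {e} {f₁} {f₂} {f₃} {g} {h} d₁ d₂ d₃ d with pair∈crossing? e g h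
... | yes e∈ with meet-at (crossing e f₁ d₁) (crossing e f₂ d₂) (inj₁ refl) (inj₁ refl)
                | meet-at (crossing e f₃ d₃) (crossing g h d) (inj₁ refl) e∈
...   | inj₁ le | _ = ≼⇒splits le
...   | inj₂ _ | inj₁ le = ≼⇒splits₂₃ le
...   | inj₂ le | inj₂ le′ = splits₂₂ le le′
splits-common {n} {e} {f₁} {f₂} {f₃} {g} {h} d₁ d₂ d₃ d | no e∉ =
  go (pair∈crossing? f₁ g h) (pair∈crossing? f₂ g h) (pair∈crossing? f₃ g h)
  where
  apart : ∀ {f l} .{d′} → ¬ (f ≡ g ⊎ f ≡ h) → crossing e f d′ ⊓ crossing g h d ⊑ segment l
  apart {f} {d′ = d′} f∉ = no-pair⇒⊑segment {y = crossing e f d′} {crossing g h d} (λ ())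
    λ { (inj₁ refl) → e∉ ; (inj₂ refl) → f∉ }

  Goal : Set
  Goal = Splits (crossing e f₁ d₁) (crossing e f₂ d₂) (crossing e f₃ d₃) (crossing g h d)

  two : f₁ ≡ f₂ ⊎ f₁ ≡ f₃ ⊎ f₂ ≡ f₃ → Goal
  two (inj₁ refl)        = ≼⇒splits ≼-refl
  two (inj₂ (inj₁ refl)) = exchange₁₂ (≼⇒splits ≼-refl)
  two (inj₂ (inj₂ refl)) = ≼⇒splits₁₂ ≼-refl

  go : Dec (f₁ ≡ g ⊎ f₁ ≡ h) → Dec (f₂ ≡ g ⊎ f₂ ≡ h) → Dec (f₃ ≡ g ⊎ f₃ ≡ h) → Goal
  go (no f∉) _ _ = exchange₂₃ (exchange₁₂ (⊑segment⇒splits (apart f∉)))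
  go _ (no f∉) _ = exchange₀₁ (exchange₂₃ (exchange₁₂ (⊑segment⇒splits (apart f∉))))
  go _ _ (no f∉) = exchange₁₂ (exchange₀₁ (exchange₂₃ (exchange₁₂ (⊑segment⇒splits (apart f∉)))))
  go (yes (inj₁ p)) (yes (inj₁ q)) _ = two (inj₁ (trans p (sym q)))
  go (yes (inj₂ p)) (yes (inj₂ q)) _ = two (inj₁ (trans p (sym q)))
  go (yes (inj₁ p)) _ (yes (inj₁ q)) = two (inj₂ (inj₁ (trans p (sym q))))
  go (yes (inj₂ p)) _ (yes (inj₂ q)) = two (inj₂ (inj₁ (trans p (sym q))))
  go _ (yes (inj₁ p)) (yes (inj₁ q)) = two (inj₂ (inj₂ (trans p (sym q))))
  go _ (yes (inj₂ p)) (yes (inj₂ q)) = two (inj₂ (inj₂ (trans p (sym q))))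

-- If each of the last three crossings shares an edge with the first, two of them share the same
-- one, so three of the four crossings have a common edge and `splits-common` applies.
splits-cccc : ∀ {e f e₁ f₁ e₂ f₂ e₃ f₃ : Edge n} .d .d₁ .d₂ .d₃ →
  Splits (crossing e f d) (crossing e₁ f₁ d₁) (crossing e₂ f₂ d₂) (crossing e₃ f₃ d₃)
splits-cccc {n} {e} {f} {e₁} {f₁} {e₂} {f₂} {e₃} {f₃} d d₁ d₂ d₃ =
  go (shares? e₁ f₁) (shares? e₂ f₂) (shares? e₃ f₃)
  where
  y : Point n
  y = crossing e f d

  Shares : Edge n → Edge n → Set
  Shares g h = (e ≡ g ⊎ e ≡ h) ⊎ (f ≡ g ⊎ f ≡ h)

  shares? : ∀ g h → Dec (Shares g h)
  shares? g h = pair∈crossing? e g h ⊎-dec pair∈crossing? f g h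

  apart : ∀ {g h l} .{d′} → ¬ Shares g h → y ⊓ crossing g h d′ ⊑ segment l
  apart {g} {h} {d′ = d′} ∉ = no-pair⇒⊑segment {y = y} {crossing g h d′} (λ ())
    λ { (inj₁ refl) → ∉ ∘ inj₁ ; (inj₂ refl) → ∉ ∘ inj₂ }

  two : ∀ {l l′ g₁ h₁ g₂ h₂ g₃ h₃} .{d′} .{d₁} .{d₂} .{d₃} → y ≼ crossing l l′ d′ →
        l ≡ g₁ ⊎ l ≡ h₁ → l ≡ g₂ ⊎ l ≡ h₂ →
        Splits y (crossing g₁ h₁ d₁) (crossing g₂ h₂ d₂) (crossing g₃ h₃ d₃)
  two {d′ = d′} {d₁} {d₂} {d₃} le p q with ∈⇒Crossing d₁ p | ∈⇒Crossing d₂ q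
  ... | _ , crosses c₁ to₁ | _ , crosses c₂ to₂ =
    splits-antitone le to₁ to₂ ≼-refl (splits-common d′ c₁ c₂ d₃)

  two-e : ∀ {g₁ h₁ g₂ h₂ g₃ h₃} .{d₁} .{d₂} .{d₃} → e ≡ g₁ ⊎ e ≡ h₁ → e ≡ g₂ ⊎ e ≡ h₂ →
          Splits y (crossing g₁ h₁ d₁) (crossing g₂ h₂ d₂) (crossing g₃ h₃ d₃)
  two-e = two {d′ = d} ≼-refl

  two-f : ∀ {g₁ h₁ g₂ h₂ g₃ h₃} .{d₁} .{d₂} .{d₃} → f ≡ g₁ ⊎ f ≡ h₁ → f ≡ g₂ ⊎ f ≡ h₂ →
          Splits y (crossing g₁ h₁ d₁) (crossing g₂ h₂ d₂) (crossing g₃ h₃ d₃)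
  two-f = two {d′ = disjoint-sym e f d} (crossing-comm e f)

  go : Dec (Shares e₁ f₁) → Dec (Shares e₂ f₂) → Dec (Shares e₃ f₃) →
       Splits y (crossing e₁ f₁ d₁) (crossing e₂ f₂ d₂) (crossing e₃ f₃ d₃)
  go (no ∉) _ _ = ⊑segment⇒splits (apart ∉)
  go _ (no ∉) _ = exchange₁₂ (⊑segment⇒splits (apart ∉))
  go _ _ (no ∉) = exchange₂₃ (exchange₁₂ (⊑segment⇒splits (apart ∉)))
  go (yes (inj₁ p)) (yes (inj₁ q)) _ = two-e p q
  go (yes (inj₂ p)) (yes (inj₂ q)) _ = two-f p q
  go (yes (inj₁ p)) _ (yes (inj₁ q)) = exchange₂₃ (two-e p q)
  go (yes (inj₂ p)) _ (yes (inj₂ q)) = exchange₂₃ (two-f p q)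
  go _ (yes (inj₁ p)) (yes (inj₁ q)) = exchange₁₂ (exchange₂₃ (two-e p q))
  go _ (yes (inj₂ p)) (yes (inj₂ q)) = exchange₁₂ (exchange₂₃ (two-f p q))

splits-all : (y₀ y₁ y₂ y₃ : Point n) → Splits y₀ y₁ y₂ y₃
splits-all (segment g) _ _ _ = segment-splits g _ _ _
splits-all _ (segment g) _ _ = exchange₀₁ (segment-splits g _ _ _)
splits-all _ _ (segment g) _ = exchange₁₂ (exchange₀₁ (segment-splits g _ _ _))
splits-all _ _ _ (segment g) = exchange₂₃ (exchange₁₂ (exchange₀₁ (segment-splits g _ _ _)))
splits-all (vertex a) (vertex b) (vertex c) (vertex d) = splits-vvvv a b c d
splits-all (vertex a) (vertex b) (vertex c) (crossing e f d) = splits-vvvc a b c e f d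
splits-all (vertex a) (vertex b) (crossing e f d) (vertex c) = exchange₂₃ (splits-vvvc a b c e f d)
splits-all (vertex a) (crossing e f d) (vertex b) (vertex c) =
  exchange₁₂ (exchange₂₃ (splits-vvvc a b c e f d))
splits-all (crossing e f d) (vertex a) (vertex b) (vertex c) =
  exchange₀₁ (exchange₁₂ (exchange₂₃ (splits-vvvc a b c e f d)))
splits-all (vertex a) (vertex b) (crossing e f d) (crossing g h d′) = splits-vvcc a b e f g h d d′
splits-all (vertex a) (crossing e f d) (vertex b) (crossing g h d′) =
  exchange₁₂ (splits-vvcc a b e f g h d d′)
splits-all (crossing e f d) (vertex a) (vertex b) (crossing g h d′) =
  exchange₀₁ (exchange₁₂ (splits-vvcc a b e f g h d d′))
splits-all (vertex a) (crossing e f d) (crossing g h d′) (vertex b) =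
  exchange₂₃ (exchange₁₂ (splits-vvcc a b e f g h d d′))
splits-all (crossing e f d) (vertex a) (crossing g h d′) (vertex b) =
  exchange₀₁ (exchange₂₃ (exchange₁₂ (splits-vvcc a b e f g h d d′)))
splits-all (crossing e f d) (crossing g h d′) (vertex a) (vertex b) =
  exchange₁₂ (exchange₀₁ (exchange₂₃ (exchange₁₂ (splits-vvcc a b e f g h d d′))))
splits-all (vertex a) (crossing _ _ d₁) (crossing _ _ d₂) (crossing _ _ d₃) = splits-vccc a d₁ d₂ d₃
splits-all (crossing _ _ d₁) (vertex a) (crossing _ _ d₂) (crossing _ _ d₃) =
  exchange₀₁ (splits-vccc a d₁ d₂ d₃)
splits-all (crossing _ _ d₁) (crossing _ _ d₂) (vertex a) (crossing _ _ d₃) =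
  exchange₁₂ (exchange₀₁ (splits-vccc a d₁ d₂ d₃))
splits-all (crossing _ _ d₁) (crossing _ _ d₂) (crossing _ _ d₃) (vertex a) =
  exchange₂₃ (exchange₁₂ (exchange₀₁ (splits-vccc a d₁ d₂ d₃)))
splits-all (crossing _ _ d) (crossing _ _ d₁) (crossing _ _ d₂) (crossing _ _ d₃) = splits-cccc d d₁ d₂ d₃

radon₂≤4 : RadonProperty (space n) 2 4
radon₂≤4 {n} P (f , f-injective , f∈P) = (λ x _ → colour x) , z , λ i → ∈-conv⁺ λ t h →
    let member : ∀ j → s j ≡ i → t ∈ f j
        member j eq = h (f j) (f∈P j , trans (colour-f j) eq)
    in common t i (member 0F) (member 1F) (member 2F) (member 3F)
  where
  open Splits (splits-all (f 0F) (f 1F) (f 2F) (f 3F))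

  s : Fin 4 → Fin 2
  s zero                   = s₀
  s (suc zero)             = s₁
  s (suc (suc zero))       = s₂
  s (suc (suc (suc zero))) = s₃

  colour : Point n → Fin 2
  colour x with any? (λ j → f j ≟ᵖ x)
  ... | yes (j , _) = s j
  -- The colour of further points of `P` is arbitrary: they only enlarge the hull of a class.
  ... | no _        = zero

  colour-f : ∀ j → colour (f j) ≡ s j
  colour-f j with any? (λ i → f i ≟ᵖ f j)
  ... | yes (_ , eq) = cong s (f-injective eq)
  ... | no ∄         = contradiction (j , refl) ∄

-- Sets of vertices without Radon partitions

Vertices : (Fin m → Fin n) → Point n → Set
Vertices ι x = ∃ λ j → x ≡ vertex (ι j)

record ColourSplit (k : ℕ) (ι : Fin m → Fin n) : Set where
  field
    colour : Fin m → Fin k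
    z      : Point n
    common : ∀ i t → (∀ j → colour j ≡ i → t ∈ vertex (ι j)) → t ∈ z

-- The colour of a point may depend on the proof of membership. Here such a proof is an index, so
-- the partition colours indices.
partition⇒split : {ι : Fin m → Fin n} → HasRadonPartition (space n) k (Vertices ι) → ColourSplit k ι
partition⇒split {ι = ι} (c , z , z∈) = record
  { colour = λ j → c (vertex (ι j)) (j , refl)
  ; z      = z
  ; common = λ i t h → ∈-conv⁻ (z∈ i) t λ { _ ((j , refl) , eq) → h j eq }
  }

vertices-atLeast : {ι : Fin m → Fin n} → Injective _≡_ _≡_ ι → k ≤ m → AtLeast (space n) k (Vertices ι)
vertices-atLeast {ι = ι} ι-injective k≤m =
  (λ j → vertex (ι (inject≤ j k≤m))) ,
  (λ eq → inject≤-injective _ _ _ _ (ι-injective (vertex-injective eq))) ,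
  λ j → _ , refl
  where
  vertex-injective : ∀ {a b} → vertex a ≡ vertex b → a ≡ b
  vertex-injective refl = refl

-- The complement of `a`, taken as a `big` probe, contains the class `i` but not `vertex a`.
split-vertex : {ι : Fin m → Fin n} (S : ColourSplit k ι) → let open ColourSplit S in
               ∀ {a} i → (∀ j → colour j ≡ i → ι j ≢ a) → z ≢ vertex a
split-vertex S {a} i avoids refl =
  toWitness {a? = ¬? (a ≟ a)}
    (ColourSplit.common S i (big λ x → ⌊ ¬? (x ≟ a) ⌋) λ j eq → fromWitness (avoids j eq)) refl

minority : (c : Fin 3 → Fin 2) → ∃ λ i → ∃ λ a → ∀ j → c j ≡ i → j ≡ a
minority c with c 0F ≟ c 1F | c 0F ≟ c 2F
-- `punchIn (c 0F) zero` is the other one of the two colours.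
... | yes p | _ = punchIn (c 0F) zero , 2F , λ where
  zero             eq → contradiction (sym eq) (punchInᵢ≢i _ _)
  (suc zero)       eq → contradiction (sym (trans p eq)) (punchInᵢ≢i _ _)
  (suc (suc zero)) _  → refl
... | no p | yes q = c 1F , 1F , λ where
  zero             eq → contradiction eq p
  (suc zero)       _  → refl
  (suc (suc zero)) eq → contradiction (trans q eq) p
... | no p | no q = c 0F , 0F , λ where
  zero             _  → refl
  (suc zero)       eq → contradiction (sym eq) p
  (suc (suc zero)) eq → contradiction (sym eq) q

-- One class has at most one vertex. An empty class contradicts `none`; a single vertex would have
-- to be `z`, but the other class avoids it.
three-vertices : {ι : Fin 3 → Fin n} → Injective _≡_ _≡_ ι → ¬ ColourSplit 2 ι
three-vertices {ι = ι} ι-injective S with minority (ColourSplit.colour S)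
... | i , a , only with ColourSplit.colour S a ≟ i
...   | no ∉ = ColourSplit.common S i none λ j eq →
        contradiction (subst (λ j → ColourSplit.colour S j ≡ i) (only j eq) eq) ∉
...   | yes a∈ = go refl (ColourSplit.common S i (single (ι a)) λ j eq → cong ι (sym (only j eq)))
  where
  go : ∀ {y} → ColourSplit.z S ≡ y → ¬ single (ι a) ∈ y
  go {vertex _} eq refl = split-vertex S (punchIn i zero) (λ where
    j j∈ ιj≡ιa → punchInᵢ≢i i zero (trans (sym j∈)
      (trans (cong (ColourSplit.colour S) (ι-injective ιj≡ιa)) a∈))) eq

4≤radon₂ : 3 ≤ n → ∀ m → RadonProperty (space n) 2 m → 4 ≤ m
4≤radon₂ 3≤n m radon with 4 ≤? m
... | yes 4≤m = 4≤m
... | no 4≰m = contradiction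
    (partition⇒split (radon (Vertices ι) (vertices-atLeast ι-injective (≤-pred (≰⇒> 4≰m)))))
    (three-vertices ι-injective)
  where
  ι : Fin 3 → Fin _
  ι j = inject≤ j 3≤n

  ι-injective : Injective _≡_ _≡_ ι
  ι-injective = inject≤-injective _ _ _ _

-- Counting vertices by colour classes

fibres-≥ : (c : Fin n → Fin k) →
           (∀ i → Σ (Fin m → Fin n) λ h → Injective _≡_ _≡_ h × (∀ j → c (h j) ≡ i)) → k * m ≤ n
fibres-≥ {n} {k} {m} c fibre = injective⇒≤ {f = uncurry u ∘ remQuot {k} m} λ {x} {y} eq →
  trans (sym (combine-remQuot {k} m x))
    (trans (cong (uncurry combine) (u-injective eq)) (combine-remQuot {k} m y))
  where
  u : Fin k → Fin m → Fin n
  u i = proj₁ (fibre i)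

  u-injective : ∀ {i j i′ j′} → u i j ≡ u i′ j′ → (i , j) ≡ (i′ , j′)
  u-injective {i} {j} {i′} {j′} eq
    with trans (sym (proj₂ (proj₂ (fibre i)) j)) (trans (cong c eq) (proj₂ (proj₂ (fibre i′)) j′))
  ... | refl = cong (i ,_) (proj₁ (proj₂ (fibre i)) eq)

Triple : (Fin n → Set) → Set
Triple Q = ∃ λ a → ∃ λ b → ∃ λ c → (a ≢ b × a ≢ c × b ≢ c) × (Q a × Q b × Q c)

triple-injection : {Q : Fin n → Set} → Triple Q →
                   Σ (Fin 3 → Fin n) λ h → Injective _≡_ _≡_ h × (∀ j → Q (h j))
triple-injection {n} {Q} (a , b , c , (a≢b , a≢c , b≢c) , (Qa , Qb , Qc)) =
  h , (λ {i} {j} → h-injective i j) , Qh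
  where
  h : Fin 3 → Fin n
  h zero             = a
  h (suc zero)       = b
  h (suc (suc zero)) = c

  Qh : ∀ j → Q (h j)
  Qh zero             = Qa
  Qh (suc zero)       = Qb
  Qh (suc (suc zero)) = Qc

  h-injective : ∀ i j → h i ≡ h j → i ≡ j
  h-injective zero             zero             _  = refl
  h-injective zero             (suc zero)       eq = contradiction eq a≢b
  h-injective zero             (suc (suc zero)) eq = contradiction eq a≢c
  h-injective (suc zero)       zero             eq = contradiction (sym eq) a≢b
  h-injective (suc zero)       (suc zero)       _  = refl
  h-injective (suc zero)       (suc (suc zero)) eq = contradiction eq b≢c
  h-injective (suc (suc zero)) zero             eq = contradiction (sym eq) a≢c
  h-injective (suc (suc zero)) (suc zero)       eq = contradiction (sym eq) b≢c
  h-injective (suc (suc zero)) (suc (suc zero)) _  = refl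

data Size (Q : Fin n → Set) : Set where
  size₀  : (∀ x → ¬ Q x) → Size Q
  size₁  : ∀ a → (∀ x → Q x → x ≡ a) → Size Q
  size₂  : ∀ a b → a ≢ b → Q a → Q b → (∀ x → Q x → x ≡ a ⊎ x ≡ b) → Size Q
  size≥₃ : Triple Q → Size Q

size : {Q : Fin n → Set} → Decidable Q → Size Q
size {Q = Q} Q? with any? Q?
... | no ∄ = size₀ λ x Qx → ∄ (x , Qx)
... | yes (a , Qa) with any? (λ x → Q? x ×-dec ¬? (a ≟ x))
...   | no ∄ = size₁ a λ x Qx → sym (decidable-stable (a ≟ x) λ a≢x → ∄ (x , Qx , a≢x))
...   | yes (b , Qb , a≢b) with any? (λ x → Q? x ×-dec (¬? (a ≟ x) ×-dec ¬? (b ≟ x)))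
...     | yes (c , Qc , a≢c , b≢c) = size≥₃ (a , b , c , (a≢b , a≢c , b≢c) , (Qa , Qb , Qc))
...     | no ∄ = size₂ a b a≢b Qa Qb λ x Qx → [ inj₁ , (λ a≢x → inj₂ (sym
            (decidable-stable (b ≟ x) λ b≢x → ∄ (x , Qx , a≢x , b≢x)))) ] (a≡x⊎a≢x x)
  where
  a≡x⊎a≢x : ∀ x → x ≡ a ⊎ a ≢ x
  a≡x⊎a≢x x with a ≟ x
  ... | yes a≡x = inj₁ (sym a≡x)
  ... | no a≢x  = inj₂ a≢x

third-colour : 3 ≤ k → (i j : Fin k) → ∃ λ l → l ≢ i × l ≢ j
third-colour (s≤s (s≤s (s≤s _))) zero          zero          = 1F , (λ ()) , λ ()
third-colour (s≤s (s≤s (s≤s _))) zero          (suc zero)    = 2F , (λ ()) , λ ()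
third-colour (s≤s (s≤s (s≤s _))) zero          (suc (suc _)) = 1F , (λ ()) , λ ()
third-colour (s≤s (s≤s (s≤s _))) (suc zero)    zero          = 2F , (λ ()) , λ ()
third-colour (s≤s (s≤s (s≤s _))) (suc (suc _)) zero          = 1F , (λ ()) , λ ()
third-colour (s≤s (s≤s (s≤s _))) (suc _)       (suc _)       = 0F , (λ ()) , λ ()

record PairClass (c : Fin n → Fin k) (z : Point n) (i : Fin k) : Set where
  field
    e      : Edge n
    e∈z    : pair e ∈ z
    class⊆ : ∀ {x} → c x ≡ i → x ∈ᵉ e
    ⊆class : ∀ {x} → x ∈ᵉ e → c x ≡ i
open PairClass

Large : (Fin n → Fin k) → Fin k → Set
Large c i = Triple λ x → c x ≡ i

-- An extra vertex of colour i₀ completes the only class that may be a pair.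
count : (c : Fin n → Fin k) (z : Point n) (i₀ : Fin k) → (∀ i → i ≢ i₀ → Large c i) →
        Large c i₀ ⊎ PairClass c z i₀ → k * 3 ≤ suc n
count {n} {k} c z i₀ large class = fibres-≥ c⁺ λ i → triple-injection (triple i)
  where
  c⁺ : Fin (suc n) → Fin k
  c⁺ zero    = i₀
  c⁺ (suc x) = c x

  lift : ∀ {i} → Large c i → Triple λ x → c⁺ x ≡ i
  lift (x , y , w , (x≢y , x≢w , y≢w) , Q) = suc x , suc y , suc w ,
    (x≢y ∘ suc-injective , x≢w ∘ suc-injective , y≢w ∘ suc-injective) , Q

  complete : Large c i₀ ⊎ PairClass c z i₀ → Triple λ x → c⁺ x ≡ i₀
  complete (inj₁ l) = lift l
  complete (inj₂ p) with e p | ⊆class p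
  ... | edge a b a<b | e⊆ = zero , suc a , suc b ,
    ((λ ()) , (λ ()) , λ eq → ⊥-elim-irr (<⇒≢ a<b (suc-injective eq))) ,
    (refl , e⊆ (inj₁ refl) , e⊆ (inj₂ refl))

  triple : ∀ i → Triple λ x → c⁺ x ≡ i
  triple i with i ≟ i₀
  ... | no i≢i₀  = lift (large i i≢i₀)
  ... | yes refl = complete class

module _ (S : ColourSplit {n} {n} k id) where
  open ColourSplit S

  -- The class itself, used as a probe, contains `z`. This excludes sizes zero and one and makes a
  -- class of size two a pair of `z`.
  class : (∀ {a} → ¬ single a ∈ z) → ∀ i → Large colour i ⊎ PairClass colour z i
  class ¬single i with size (λ x → colour x ≟ i)
  ... | size₀ empty  = ⊥-elim (common i none empty)
  ... | size₁ a only = contradiction (common i (single a) λ x eq → sym (only x eq)) ¬single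
  ... | size≥₃ large = inj₁ large
  ... | size₂ a b a≢b a∈ b∈ only = inj₂ record
    { e      = join a≢b
    ; e∈z    = common i (pair (join a≢b)) λ _ → class⊆′
    ; class⊆ = class⊆′
    ; ⊆class = λ x∈ → [ (λ { refl → a∈ }) , (λ { refl → b∈ }) ] (∈-join⁻ a≢b x∈)
    }
    where
    class⊆′ : ∀ {x} → colour x ≡ i → x ∈ᵉ join a≢b
    class⊆′ {x} eq with only x eq
    ... | inj₁ refl = ∈-joinˡ a≢b
    ... | inj₂ refl = ∈-joinʳ a≢b

  -- A class of size two must be `g`, so only the class of `lo g` can be one.
  segment-count : ∀ {g} → z ≡ segment g → k * 3 ≤ suc n
  segment-count {g} refl = count colour z i₀ large (class (λ ()) i₀)
    where
    i₀ = colour (lo g)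

    large : ∀ i → i ≢ i₀ → Large colour i
    large i i≢i₀ with class (λ ()) i
    ... | inj₁ l = l
    ... | inj₂ p with e p | e∈z p | ⊆class p
    ...   | _ | refl | g⊆ = contradiction (sym (g⊆ (inj₁ refl))) i≢i₀

  -- Only the classes of `lo f` and `lo g` can have size two. As soon as one of them is large,
  -- `count` applies with the other as the exception.
  crossing-count : 3 ≤ k → ∀ {f g} .{d} → z ≡ crossing f g d → k * 3 ≤ suc n
  crossing-count 3≤k {f} {g} {d} refl = go (class (λ ()) i₁) (class (λ ()) i₂)
    where
    i₁ = colour (lo f)
    i₂ = colour (lo g)

    large : ∀ i → i ≢ i₁ → i ≢ i₂ → Large colour i
    large i i≢i₁ i≢i₂ with class (λ ()) i
    ... | inj₁ l = l
    ... | inj₂ p with e p | e∈z p | ⊆class p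
    ...   | _ | inj₁ refl | f⊆ = contradiction (sym (f⊆ (inj₁ refl))) i≢i₁
    ...   | _ | inj₂ refl | g⊆ = contradiction (sym (g⊆ (inj₁ refl))) i≢i₂

    -- The pair is `f` and not `g`, because the class contains `lo f`.
    f-class : PairClass colour z i₁ → ∀ {x} → x ∈ᵉ f → colour x ≡ i₁
    f-class p with e p | e∈z p | class⊆ p {lo f} refl | ⊆class p
    ... | _ | inj₁ refl | _  | f⊆ = f⊆
    ... | _ | inj₂ refl | a∈ | _  = ⊥-elim-irr (d _ (inj₁ refl) a∈)

    g-class : PairClass colour z i₂ → ∀ {x} → x ∈ᵉ g → colour x ≡ i₂
    g-class p with e p | e∈z p | class⊆ p {lo g} refl | ⊆class p
    ... | _ | inj₁ refl | a∈ | _  = ⊥-elim-irr (d _ a∈ (inj₁ refl))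
    ... | _ | inj₂ refl | _  | g⊆ = g⊆

    go : Large colour i₁ ⊎ PairClass colour z i₁ → Large colour i₂ ⊎ PairClass colour z i₂ → k * 3 ≤ suc n
    go (inj₁ l) q = count colour z i₂ large′ q
      where
      large′ : ∀ i → i ≢ i₂ → Large colour i
      large′ i i≢i₂ with i ≟ i₁
      ... | yes refl = l
      ... | no i≢i₁  = large i i≢i₁ i≢i₂
    go p (inj₁ l) = count colour z i₁ large′ p
      where
      large′ : ∀ i → i ≢ i₁ → Large colour i
      large′ i i≢i₁ with i ≟ i₂
      ... | yes refl = l
      ... | no i≢i₂  = large i i≢i₁ i≢i₂
    -- If f and g are both classes, no third class meets f ∪ g.
    go (inj₂ p) (inj₂ q) with third-colour 3≤k i₁ i₂
    ... | i , i≢i₁ , i≢i₂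
      with common i (big λ x → ⌊ colour x ≟ i ⌋) (λ _ → fromWitness)
    ...   | _ , inj₁ v∈f , v∈i = contradiction (trans (sym (toWitness v∈i)) (f-class p v∈f)) i≢i₁
    ...   | _ , inj₂ v∈g , v∈i = contradiction (trans (sym (toWitness v∈i)) (g-class q v∈g)) i≢i₂

  split⇒≤ : 3 ≤ k → k * 3 ≤ suc n
  split⇒≤ 3≤k = go refl
    where
    go : ∀ {y} → z ≡ y → k * 3 ≤ suc n
    -- Any colour other than that of `a` gives a class avoiding `a`.
    go {vertex a} eq with third-colour 3≤k (colour a) (colour a)
    ... | i , i≢ , _ = contradiction eq (split-vertex S i λ { j refl refl → i≢ refl })
    go {segment _}      = segment-count
    go {crossing _ _ _} = crossing-count 3≤k

theorem2 : (k : ℕ) → 3 ≤ k →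
    Σ Set λ X → Σ (ConvexitySpace X) λ S →
    IsRadonNumber S 2 4 × RadonNumberAtLeast S k (3 * (k ∸ 1) + 2)
theorem2 k@(suc l@(suc (suc j))) 3≤k@(s≤s (s≤s (s≤s _))) =
  Point n₀ , space n₀ , (radon₂≤4 , 4≤radon₂ 3≤n₀) , λ radon →
    -- A partition would give `3 * k ≤ n₀ + 1`, whereas `3 * k` equals `n₀ + 2`.
    n≮n _ (≤-trans (≤-reflexive (trans 2+n₀≡3k (*-comm 3 k)))
      (split⇒≤ (partition⇒split (radon (Vertices id) (vertices-atLeast id ≤-refl))) 3≤k))
  where
  n₀ : ℕ
  -- One less than the claimed bound, which is `3k - 2` since `l` is `k - 1`. Matching `k` down to
  -- three successors lets the subtraction compute.
  n₀ = 3 * l + 2 ∸ 1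

  3≤n₀ : 3 ≤ n₀
  3≤n₀ = ≤-pred (+-monoˡ-≤ 2 {2} {3 * l} (s≤s (s≤s z≤n)))

  2+n₀≡3k : suc (suc n₀) ≡ 3 * k
  2+n₀≡3k = trans (cong suc (+-comm (3 * l) 2)) (sym (*-suc 3 l))
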